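{- Let $\chi$ be a Dirichlet character with odd conductor $d\in\mathbb{N}$, and let $w_1,w_2\in\mathbb{N}$ be odd positive integers. Then for every integer $l\ge 0$, as an identity of polynomials in $x$, $$\sum_{i=0}^{l}\binom{l}{i}E_{i,\chi}(w_2x)\,T_{l-i,\chi}(dw_1-1)\,w_1^{i}w_2^{l-i}=\sum_{i=0}^{l}\binom{l}{i}E_{i,\chi}(w_1x)\,T_{l-i,\chi}(dw_2-1)\,w_2^{i}w_1^{l-i}.$$
   Context: $\mathbb{N}$ denotes the positive integers. A Dirichlet character $\chi$ of conductor $d$ is regarded as a $d$-periodic function on $\mathbb{Z}$, with $\chi(l)=0$ when $\gcd(l,d)>1$ (for $d=1$, $\chi$ is identically $1$). Its values may be taken in $\mathbb{C}$, or in $\mathbb{C}_p$ for an odd prime $p$ with $\gcd(p,d)=1$. The generalized Euler polynomials $E_{n,\chi}(x)$ ($n\ge 0$) attached to $\chi$ are defined by the formal power series identity in $t$ $$\frac{2\sum_{l=0}^{d-1}(-1)^l\chi(l)e^{lt}}{e^{dt}+1}\,e^{xt}=\sum_{n=0}^{\infty}E_{n,\chi}(x)\frac{t^n}{n!}.$$ For integers $k,n\ge 0$, set $$T_{k,\chi}(n)=2\sum_{l=0}^{n}(-1)^l\chi(l)\,l^k,$$ with the convention $0^0=1$. -}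

module Defs where

open import Level using (Level; _⊔_)
open import Algebra.Apartness.Bundles using (HeytingField)
open import Algebra.Bundles using (CommutativeRing; RawRing)
import Algebra.Definitions
import Algebra.Definitions.RawSemiring as RawSemiringDefs
import Algebra.Properties.Group
open import Data.Fin.Base using (toℕ)
open import Data.Integer.Base as ℤ using (ℤ; +_)
open import Data.Integer.GCD using (gcd)
open import Data.List.Base using (List; []; _∷_; map)
open import Data.Nat.Base as ℕ using (ℕ; zero; suc; _≤_; NonZero; _∸_; _!; parity)
open import Data.Nat.Divisibility using (_∣_)
open import Data.Nat.Properties using (_!≢0)
open import Data.Parity.Base using (1ℙ)
open import Data.Product.Base as Product using (_,_; ∃-syntax; proj₁; proj₂)
open import Relation.Binary.PropositionalEquality.Core using (_≡_)
import Relation.Binary.Reasoning.Setoid as SetoidReasoning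

private
  variable
    c ℓ ℓ₁ ℓ₂ : Level

Odd : ℕ → Set
Odd n = parity n ≡ 1ℙ

module RingNotation (R : RawRing c ℓ) where
  open RawRing R using (Carrier; rawSemiring; 1#)
  open RawSemiringDefs rawSemiring public using (_×_; _^_; sum)

  -- ∑ n f = f 0 + … + f (n − 1)
  ∑ : ℕ → (ℕ → Carrier) → Carrier
  ∑ n f = sum {n} (λ i → f (toℕ i))

  ι : ℕ → Carrier
  ι n = n × 1#

module PowerSeries (R : RawRing c ℓ) where
  open RawRing R
  open RingNotation R

  Series : Set c
  Series = ℕ → Carrier

  infixr 7 _•_
  _•_ : Carrier → Series → Series
  (a • f) n = a * f n

  rawRing : RawRing c ℓ
  rawRing = record
    { Carrier = Series
    ; _≈_     = λ f g → ∀ n → f n ≈ g n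
    ; _+_     = λ f g n → f n + g n
    ; _*_     = λ f g n → ∑ (suc n) (λ k → f k * g (n ∸ k))
    ; -_      = λ f n → - f n
    ; 0#      = λ _ → 0#
    ; 1#      = λ { zero → 1# ; (suc _) → 0# }
    }

-- A polynomial is the list of its coefficients, constant term first; trailing
-- zeros are allowed, so equality is equality of all coefficients.
module Polynomial (R : RawRing c ℓ) where
  open RawRing R

  Poly : Set c
  Poly = List Carrier

  coeff : Poly → ℕ → Carrier
  coeff []      _       = 0#
  coeff (a ∷ _) zero    = a
  coeff (_ ∷ p) (suc n) = coeff p n

  infix  4 _≈ₚ_
  infixl 6 _+ₚ_
  infixl 7 _*ₚ_
  infixr 7 _•_

  _≈ₚ_ : Poly → Poly → Set ℓ
  p ≈ₚ q = ∀ n → coeff p n ≈ coeff q n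

  _•_ : Carrier → Poly → Poly
  a • p = map (a *_) p

  _+ₚ_ : Poly → Poly → Poly
  []      +ₚ q       = q
  (a ∷ p) +ₚ []      = a ∷ p
  (a ∷ p) +ₚ (b ∷ q) = (a + b) ∷ (p +ₚ q)

  _*ₚ_ : Poly → Poly → Poly
  []      *ₚ q = []
  (a ∷ p) *ₚ q = a • q +ₚ (0# ∷ p *ₚ q)

  const : Carrier → Poly
  const a = a ∷ []

  X : Poly
  X = 0# ∷ 1# ∷ []

  rawRing : RawRing c ℓ
  rawRing = record
    { Carrier = Poly
    ; _≈_     = _≈ₚ_
    ; _+_     = _+ₚ_
    ; _*_     = _*ₚ_
    ; -_      = map -_
    ; 0#      = []
    ; 1#      = const 1#
    }

  -- p ⟨ q ⟩ is p(q(x)).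
  infix 8 _⟨_⟩
  _⟨_⟩ : Poly → Poly → Poly
  []      ⟨ q ⟩ = []
  (a ∷ p) ⟨ q ⟩ = const a +ₚ q *ₚ (p ⟨ q ⟩)

module _ (F : HeytingField c ℓ₁ ℓ₂) where
  open HeytingField F

  fieldCommutativeRing : CommutativeRing c ℓ₁
  fieldCommutativeRing = record { isCommutativeRing = isCommutativeRing }

  fieldRawRing : RawRing c ℓ₁
  fieldRawRing = CommutativeRing.rawRing fieldCommutativeRing

  CharacteristicZero : Set ℓ₂
  CharacteristicZero = ∀ n → .{{NonZero n}} → RingNotation.ι fieldRawRing n # 0#

-- F is the field in which characters take their values, for instance ℂ or ℂₚ.
module GeneralizedEuler (F : HeytingField c ℓ₁ ℓ₂) (char0 : CharacteristicZero F) where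
  open HeytingField F public
  open Algebra.Definitions _≈_ using (Invertible)
  open Algebra.Properties.Group (CommutativeRing.+-group (fieldCommutativeRing F))
    using (ε⁻¹≈ε)
  open RingNotation (fieldRawRing F) public
  open Polynomial (fieldRawRing F) public renaming (rawRing to F[x])
  open PowerSeries (fieldRawRing F) using (Series) renaming (rawRing to F[[t]]; _•_ to _•ˢ_)
  open PowerSeries F[x] using () renaming (Series to Seriesₚ; rawRing to F[x][[t]])
  open RawRing F[[t]] using () renaming (_≈_ to _≈ˢ_; _+_ to _+ˢ_; _*_ to _*ˢ_; 1# to 1ˢ)
  open RawRing F[x][[t]] using () renaming (_*_ to _*ₚˢ_)
  open RingNotation F[x] public using () renaming (∑ to ∑ₚ; _^_ to _^ₚ_)
  open RingNotation F[[t]] using () renaming (∑ to ∑ˢ; _×_ to _×ˢ_)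

  private
    x-0≈x : ∀ x → x - 0# ≈ x
    x-0≈x x = trans (+-cong refl ε⁻¹≈ε) (+-identityʳ x)

  inv : ∀ {x} → x # 0# → Carrier
  inv x#0 = proj₁ (#⇒invertible x#0)

  inv-inverseˡ : ∀ {x} (x#0 : x # 0#) → inv x#0 * x ≈ 1#
  inv-inverseˡ {x} x#0 =
    trans (*-cong refl (sym (x-0≈x x))) (proj₁ (proj₂ (#⇒invertible x#0)))

  #0-resp-≈ : ∀ {x y} → x ≈ y → x # 0# → y # 0#
  #0-resp-≈ {x} {y} x≈y x#0 = invertible⇒#
    ( inv x#0
    , trans (*-cong refl y-0≈x) (inv-inverseˡ x#0)
    , trans (*-cong y-0≈x refl) (trans (*-comm x _) (inv-inverseˡ x#0))
    )
    where
    y-0≈x : y - 0# ≈ x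
    y-0≈x = trans (x-0≈x y) (sym x≈y)

  1/_! : ℕ → Carrier
  1/ n ! = inv (char0 (n !) {{n !≢0}})

  -- Long division: with q₀ = f₀ / g₀, f / g = q₀ + t · (((f − q₀ g) / t) / g).
  quotient : (f g : Series) → g 0 # 0# → Series
  quotient f g g₀#0 zero    = f 0 * inv g₀#0
  quotient f g g₀#0 (suc n) =
    quotient (λ k → f (suc k) - (f 0 * inv g₀#0) * g (suc k)) g g₀#0 n

  quotient-correct : ∀ f g (g₀#0 : g 0 # 0#) → quotient f g g₀#0 *ˢ g ≈ˢ f
  quotient-correct f g g₀#0 zero = begin
    f 0 * inv g₀#0 * g 0 + 0#  ≈⟨ +-identityʳ _ ⟩
    f 0 * inv g₀#0 * g 0       ≈⟨ *-assoc _ _ _ ⟩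
    f 0 * (inv g₀#0 * g 0)     ≈⟨ *-cong refl (inv-inverseˡ g₀#0) ⟩
    f 0 * 1#                   ≈⟨ *-identityʳ _ ⟩
    f 0                        ∎
    where open SetoidReasoning (CommutativeRing.setoid (fieldCommutativeRing F))
  quotient-correct f g g₀#0 (suc n) = begin
    q₀g + (quotient f′ g g₀#0 *ˢ g) n  ≈⟨ +-cong refl (quotient-correct f′ g g₀#0 n) ⟩
    q₀g + (f (suc n) - q₀g)            ≈⟨ +-cong refl (+-comm _ _) ⟩
    q₀g + (- q₀g + f (suc n))          ≈⟨ +-assoc _ _ _ ⟨
    (q₀g - q₀g) + f (suc n)            ≈⟨ +-cong (-‿inverseʳ _) refl ⟩
    0# + f (suc n)                     ≈⟨ +-identityˡ _ ⟩
    f (suc n)                          ∎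
    where
    open SetoidReasoning (CommutativeRing.setoid (fieldCommutativeRing F))
    q₀g : Carrier
    q₀g = f 0 * inv g₀#0 * g (suc n)
    f′ : Series
    f′ k = f (suc k) - (f 0 * inv g₀#0) * g (suc k)

  -- e^{at} ∈ F[[t]] for a ∈ F, and e^{xt} ∈ F[x][[t]].
  exp : Carrier → Series
  exp a n = 1/ n ! * a ^ n

  expX : Seriesₚ
  expX n = 1/ n ! • X ^ₚ n

  denominator : ℕ → Series
  denominator d = exp (ι d) +ˢ 1ˢ

  denominator₀#0 : ∀ d → denominator d 0 # 0#
  denominator₀#0 d = #0-resp-≈ (sym eq) (char0 2)
    where
    open SetoidReasoning (CommutativeRing.setoid (fieldCommutativeRing F))
    eq : denominator d 0 ≈ 1# + (1# + 0#)
    eq = begin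
      1/ 0 ! * 1# + 1#         ≈⟨ +-cong (*-cong refl (sym (+-identityʳ 1#))) refl ⟩
      1/ 0 ! * (1# + 0#) + 1#  ≈⟨ +-cong (inv-inverseˡ (char0 1)) refl ⟩
      1# + 1#                  ≈⟨ +-cong refl (sym (+-identityʳ 1#)) ⟩
      1# + (1# + 0#)           ∎

  -- A Dirichlet character modulo d, extended by zero to ℤ.
  record DirichletCharacter (d : ℕ) : Set (c ⊔ ℓ₁) where
    field
      χ              : ℤ → Carrier
      periodic       : ∀ a → χ (a ℤ.+ + d) ≈ χ a
      multiplicative : ∀ a b → χ (a ℤ.* b) ≈ χ a * χ b
      unit           : χ (+ 1) ≈ 1#
      vanishing      : ∀ a → + 1 ℤ.< gcd a (+ d) → χ a ≈ 0#

  open DirichletCharacter using (χ)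

  InducedFrom : ∀ {d} → DirichletCharacter d → ℕ → Set (c ⊔ ℓ₁)
  InducedFrom {d} ψ m =
    ∃[ φ ] (∀ a → gcd a (+ d) ≡ + 1 → χ ψ a ≈ χ {m} φ a)

  -- ψ has conductor f; "conductor d" for a character modulo d means primitive.
  HasConductor : ∀ {d} → DirichletCharacter d → ℕ → Set (c ⊔ ℓ₁)
  HasConductor {d} ψ f =
    f ∣ d Product.× InducedFrom ψ f Product.× (∀ m → m ∣ d → InducedFrom ψ m → f ≤ m)

  numerator : ∀ {d} → DirichletCharacter d → Series
  numerator {d} ψ = 2 ×ˢ ∑ˢ d (λ l → ((- 1#) ^ l * χ ψ (+ l)) •ˢ exp (ι l))

  generatingSeries : ∀ {d} → DirichletCharacter d → Seriesₚ
  generatingSeries {d} ψ =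
    (λ n → const (quotient (numerator ψ) (denominator d) (denominator₀#0 d) n)) *ₚˢ expX

  E : ∀ {d} → DirichletCharacter d → ℕ → Poly
  E ψ n = ι (n !) • generatingSeries ψ n

  -- x ^ 0 is 1#, also for x = 0#.
  T : ∀ {d} → DirichletCharacter d → ℕ → ℕ → Carrier
  T ψ k n = 2 × ∑ (suc n) (λ l → (- 1#) ^ l * χ ψ (+ l) * ι l ^ k)

{-# OPTIONS --safe #-}

-- Write Q for the quotient series attached to ψ, so that E ψ i is i! times the
-- i-th coefficient of Q(t) e^{xt}, and τ w = powerSumSeries ψ (d w) for
-- ∑ₖ T ψ k (d w − 1) tᵏ / k!.
-- Splitting 0, …, d w − 1 into blocks of length d gives, for odd d and w,
--   τ w = Q (e^{dwt} + 1).
-- Up to the factor l!, the left-hand side is the l-th coefficient of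
--   Q(w₁t) e^{w₁w₂xt} τ w₁ (w₂t) = Q(w₁t) Q(w₂t) e^{w₁w₂xt} (e^{dw₁w₂t} + 1),
-- which is symmetric in w₁ and w₂.

module Submission where

open import Defs
open import Algebra.Apartness.Bundles using (HeytingField)
open import Algebra.Bundles using (CommutativeRing; RawRing)
import Algebra.Properties.AbelianGroup
import Algebra.Properties.CommutativeSemigroup
import Algebra.Properties.CommutativeSemiring.Binomial
import Algebra.Properties.CommutativeSemiring.Exp
import Algebra.Properties.Monoid.Mult
import Algebra.Properties.Ring
import Algebra.Properties.Semiring.Exp
import Algebra.Properties.Semiring.Mult
import Algebra.Properties.Semiring.Sum
import Algebra.Solver.Ring.NaturalCoefficients.Default as Solver
open import Data.Fin.Base using (toℕ)
open import Data.Fin.Properties using (toℕ<n)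
open import Data.Integer.Base using (+_)
open import Data.List.Base using ([]; _∷_)
open import Data.Nat.Base as ℕ using (ℕ; zero; suc; _≤_; _<_; _∸_; _!; NonZero; s≤s⁻¹)
open import Data.Nat.Combinatorics using (_C_; nCk≡n!/k![n-k]!; k![n∸k]!∣n!)
open import Data.Nat.DivMod using (m/n*n≡m)
import Data.Nat.Properties as ℕ
open import Data.Nat.Properties using (_!≢0; _!*_!≢0)
open import Data.Product.Base using (_,_)
open import Level using (Level)
open import Relation.Binary.PropositionalEquality.Core as ≡ using (_≡_)
import Relation.Binary.Reasoning.MultiSetoid as MultiSetoidReasoning
import Relation.Binary.Reasoning.Setoid as SetoidReasoning

private
  variable
    c ℓ ℓ₁ ℓ₂ : Level

-- Arithmetic of factorials and odd numbers.

nCk*k!*[n∸k]!≡n! : ∀ {n k} → k ≤ n → (n C k) ℕ.* (k ! ℕ.* (n ∸ k) !) ≡ n !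
nCk*k!*[n∸k]!≡n! {n} {k} k≤n =
  ≡.trans (≡.cong (ℕ._* (k ! ℕ.* (n ∸ k) !)) (nCk≡n!/k![n-k]! k≤n))
          (m/n*n≡m {{k !* (n ∸ k) !≢0}} (k![n∸k]!∣n! k≤n))

odd⇒nonZero : ∀ {n} → Odd n → NonZero n
odd⇒nonZero {suc n} _ = _

-- Finite sums and signs in a commutative ring.

module RingProperties (R : CommutativeRing c ℓ) where
  open CommutativeRing R
  open RingNotation rawRing
  open Algebra.Properties.Ring ring using (-‿distribˡ-*; -‿distribʳ-*)
  open Algebra.Properties.AbelianGroup +-abelianGroup using (⁻¹-involutive)
  open Algebra.Properties.Semiring.Sum semiring using (sum-cong-≋; *-distribˡ-sum)
  open SetoidReasoning setoid

  ∑-cong : ∀ n {f g : ℕ → Carrier} → (∀ i → i < n → f i ≈ g i) → ∑ n f ≈ ∑ n g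
  ∑-cong n f≈g = sum-cong-≋ {n} (λ i → f≈g (toℕ i) (toℕ<n i))

  ∑-split : ∀ m n f → ∑ (m ℕ.+ n) f ≈ ∑ m f + ∑ n (λ i → f (m ℕ.+ i))
  ∑-split zero    n f = sym (+-identityˡ _)
  ∑-split (suc m) n f =
    trans (+-congˡ (∑-split m n (λ i → f (suc i)))) (sym (+-assoc _ _ _))

  *-distribˡ-∑ : ∀ n x f → x * ∑ n f ≈ ∑ n (λ i → x * f i)
  *-distribˡ-∑ n x f = *-distribˡ-sum {n} x (λ i → f (toℕ i))

  -x*-y≈x*y : ∀ x y → - x * - y ≈ x * y
  -x*-y≈x*y x y = begin
    - x * - y      ≈⟨ -‿distribˡ-* x (- y) ⟨
    - (x * - y)    ≈⟨ -‿cong (-‿distribʳ-* x y) ⟨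
    - (- (x * y))  ≈⟨ ⁻¹-involutive _ ⟩
    x * y          ∎

  [-x]^odd : ∀ x {n} → Odd n → (- x) ^ n ≈ - (x ^ n)
  [-x]^odd x {suc zero}    _   = sym (-‿distribˡ-* x 1#)
  -- `parity` removes two successors at a time, so `odd` itself proves that n is odd.
  [-x]^odd x {suc (suc n)} odd = begin
    - x * (- x * (- x) ^ n)      ≈⟨ *-congˡ (*-congˡ ([-x]^odd x {n} odd)) ⟩
    - x * (- x * - (x ^ n))      ≈⟨ *-congˡ (-x*-y≈x*y x _) ⟩
    - x * (x * x ^ n)            ≈⟨ -‿distribˡ-* x _ ⟨
    - (x * (x * x ^ n))          ∎

-- Formal power series form a commutative ring.

module PowerSeriesProperties (R : CommutativeRing c ℓ) where
  open CommutativeRing R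
  open RingNotation rawRing
  open RingProperties R
  open Algebra.Properties.Semiring.Exp semiring using (^-homo-*; ^-congʳ)
  open Solver commutativeSemiring using (solve; _:=_; _:+_; _:*_; con)
  open PowerSeries rawRing using (Series; _•_) renaming (rawRing to seriesRawRing)
  open RawRing seriesRawRing using ()
    renaming (_≈_ to _≈ˢ_; _+_ to _+ˢ_; _*_ to _*ˢ_; -_ to -ˢ_; 0# to 0ˢ; 1# to 1ˢ)
  open RingNotation seriesRawRing using () renaming (∑ to ∑ˢ)
  open SetoidReasoning setoid

  private
    -- `(f *ˢ g) (suc n)` computes to `f 0 * g (suc n) + (tail f *ˢ g) n`, so the ring laws follow
    -- by induction on the index, generalised over the left factor.
    tail : Series → Series
    tail f n = f (suc n)

  *ˢ-cong : ∀ {f f′ g g′} → f ≈ˢ f′ → g ≈ˢ g′ → f *ˢ g ≈ˢ f′ *ˢ g′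
  *ˢ-cong f≈f′ g≈g′ n = ∑-cong (suc n) (λ k _ → *-cong (f≈f′ k) (g≈g′ (n ∸ k)))

  *ˢ-distribʳ-+ˢ : ∀ h f g → (f +ˢ g) *ˢ h ≈ˢ f *ˢ h +ˢ g *ˢ h
  *ˢ-distribʳ-+ˢ h f g zero    =
    solve 3 (λ h f g → (f :+ g) :* h :+ con 0 := (f :* h :+ con 0) :+ (g :* h :+ con 0))
      refl (h 0) (f 0) (g 0)
  *ˢ-distribʳ-+ˢ h f g (suc n) = begin
    (f 0 + g 0) * h (suc n) + ((tail f +ˢ tail g) *ˢ h) n
      ≈⟨ +-congˡ (*ˢ-distribʳ-+ˢ h (tail f) (tail g) n) ⟩
    (f 0 + g 0) * h (suc n) + ((tail f *ˢ h) n + (tail g *ˢ h) n)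
      ≈⟨ solve 5 (λ a b h u v → (a :+ b) :* h :+ (u :+ v) := (a :* h :+ u) :+ (b :* h :+ v))
           refl (f 0) (g 0) (h (suc n)) _ _ ⟩
    (f *ˢ h) (suc n) + (g *ˢ h) (suc n) ∎

  •-*ˢ-assoc : ∀ a f g → (a • f) *ˢ g ≈ˢ a • (f *ˢ g)
  •-*ˢ-assoc a f g n = trans
    (∑-cong (suc n) (λ k _ → *-assoc a (f k) (g (n ∸ k))))
    (sym (*-distribˡ-∑ (suc n) a (λ k → f k * g (n ∸ k))))

  *ˢ-assoc : ∀ f g h → (f *ˢ g) *ˢ h ≈ˢ f *ˢ (g *ˢ h)
  *ˢ-assoc f g h zero    =
    solve 3 (λ f g h → (f :* g :+ con 0) :* h :+ con 0 := f :* (g :* h :+ con 0) :+ con 0)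
      refl (f 0) (g 0) (h 0)
  *ˢ-assoc f g h (suc n) = begin
    -- By computation, `tail (f *ˢ g)` is `f 0 • tail g +ˢ tail f *ˢ g`.
    (f 0 * g 0 + 0#) * h (suc n) + ((f 0 • tail g +ˢ tail f *ˢ g) *ˢ h) n
      ≈⟨ +-congˡ (*ˢ-distribʳ-+ˢ h (f 0 • tail g) (tail f *ˢ g) n) ⟩
    (f 0 * g 0 + 0#) * h (suc n) + (((f 0 • tail g) *ˢ h) n + ((tail f *ˢ g) *ˢ h) n)
      ≈⟨ +-congˡ (+-cong (•-*ˢ-assoc (f 0) (tail g) h n) (*ˢ-assoc (tail f) g h n)) ⟩
    (f 0 * g 0 + 0#) * h (suc n) + (f 0 * (tail g *ˢ h) n + (tail f *ˢ (g *ˢ h)) n)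
      ≈⟨ solve 5 (λ a b c d e → (a :* b :+ con 0) :* c :+ (a :* d :+ e)
                             := a :* (b :* c :+ d) :+ e)
           refl (f 0) (g 0) (h (suc n)) _ _ ⟩
    (f *ˢ (g *ˢ h)) (suc n) ∎

  -- The convolution peels its left factor by computation; this is the mirror image for the right
  -- factor, which the induction for commutativity needs.
  *ˢ-suc : ∀ f g n → (f *ˢ g) (suc n) ≈ f (suc n) * g 0 + (f *ˢ tail g) n
  *ˢ-suc f g zero    =
    solve 4 (λ a b c d → a :* b :+ (c :* d :+ con 0) := c :* d :+ (a :* b :+ con 0))
      refl (f 0) (g 1) (f 1) (g 0)
  *ˢ-suc f g (suc n) = begin
    f 0 * g (suc (suc n)) + (tail f *ˢ g) (suc n)
      ≈⟨ +-congˡ (*ˢ-suc (tail f) g n) ⟩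
    f 0 * g (suc (suc n)) + (f (suc (suc n)) * g 0 + (tail f *ˢ tail g) n)
      ≈⟨ solve 3 (λ u v w → u :+ (v :+ w) := v :+ (u :+ w)) refl _ _ _ ⟩
    f (suc (suc n)) * g 0 + (f *ˢ tail g) (suc n) ∎

  *ˢ-comm : ∀ f g → f *ˢ g ≈ˢ g *ˢ f
  *ˢ-comm f g zero    = +-congʳ (*-comm _ _)
  *ˢ-comm f g (suc n) = begin
    f 0 * g (suc n) + (tail f *ˢ g) n  ≈⟨ +-cong (*-comm _ _) (*ˢ-comm (tail f) g n) ⟩
    g (suc n) * f 0 + (g *ˢ tail f) n  ≈⟨ *ˢ-suc g f n ⟨
    (g *ˢ f) (suc n)                   ∎

  *ˢ-zeroˡ : ∀ f → 0ˢ *ˢ f ≈ˢ 0ˢ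
  *ˢ-zeroˡ f zero    = trans (+-identityʳ _) (zeroˡ _)
  *ˢ-zeroˡ f (suc n) = trans (+-cong (zeroˡ _) (*ˢ-zeroˡ f n)) (+-identityˡ _)

  *ˢ-identityˡ : ∀ f → 1ˢ *ˢ f ≈ˢ f
  *ˢ-identityˡ f zero    = trans (+-identityʳ _) (*-identityˡ _)
  *ˢ-identityˡ f (suc n) =
    trans (+-cong (*-identityˡ _) (*ˢ-zeroˡ f n)) (+-identityʳ _)

  seriesCommutativeRing : CommutativeRing c ℓ
  seriesCommutativeRing = record
    { Carrier = Series
    ; _≈_     = _≈ˢ_
    ; _+_     = _+ˢ_
    ; _*_     = _*ˢ_
    ; -_      = -ˢ_
    ; 0#      = 0ˢ
    ; 1#      = 1ˢ
    ; isCommutativeRing = record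
      { isRing = record
        { +-isAbelianGroup = record
          { isGroup = record
            { isMonoid = record
              { isSemigroup = record
                { isMagma = record
                  { isEquivalence = record
                    { refl  = λ _ → refl
                    ; sym   = λ f≈g n → sym (f≈g n)
                    ; trans = λ f≈g g≈h n → trans (f≈g n) (g≈h n)
                    }
                  ; ∙-cong = λ f≈f′ g≈g′ n → +-cong (f≈f′ n) (g≈g′ n)
                  }
                ; assoc = λ f g h n → +-assoc (f n) (g n) (h n)
                }
              ; identity = (λ f n → +-identityˡ (f n)) , (λ f n → +-identityʳ (f n))
              }
            ; inverse = (λ f n → -‿inverseˡ (f n)) , (λ f n → -‿inverseʳ (f n))
            ; ⁻¹-cong = λ f≈g n → -‿cong (f≈g n)
            }
          ; comm = λ f g n → +-comm (f n) (g n)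
          }
        ; *-cong     = *ˢ-cong
        ; *-assoc    = *ˢ-assoc
        ; *-identity = *ˢ-identityˡ
                     , (λ f n → trans (*ˢ-comm f 1ˢ n) (*ˢ-identityˡ f n))
        ; distrib    = (λ f g h n → trans (*ˢ-comm f (g +ˢ h) n)
                                   (trans (*ˢ-distribʳ-+ˢ f g h n)
                                          (+-cong (*ˢ-comm g f n) (*ˢ-comm h f n))))
                     , *ˢ-distribʳ-+ˢ
        }
      ; *-comm = *ˢ-comm
      }
    }

  ∑ˢ-lookup : ∀ n (f : ℕ → Series) k → ∑ˢ n f k ≈ ∑ n (λ i → f i k)
  ∑ˢ-lookup zero    f k = refl
  ∑ˢ-lookup (suc n) f k = +-congˡ (∑ˢ-lookup n (λ i → f (suc i)) k)

  -- The substitution of at for t.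

  -- scale a f is f(at).
  scale : Carrier → Series → Series
  scale a f n = a ^ n * f n

  scale-cong : ∀ a {f g} → f ≈ˢ g → scale a f ≈ˢ scale a g
  scale-cong a f≈g n = *-congˡ (f≈g n)

  -- In each term of the convolution, a^n splits as a^k a^(n-k).
  scale-*ˢ : ∀ a f g → scale a (f *ˢ g) ≈ˢ scale a f *ˢ scale a g
  scale-*ˢ a f g n = trans
    (*-distribˡ-∑ (suc n) (a ^ n) (λ k → f k * g (n ∸ k)))
    (∑-cong (suc n) λ k k<1+n → begin
      a ^ n * (f k * g (n ∸ k))
        ≈⟨ *-congʳ (^-congʳ a (≡.sym (ℕ.m+[n∸m]≡n (s≤s⁻¹ k<1+n)))) ⟩
      a ^ (k ℕ.+ (n ∸ k)) * (f k * g (n ∸ k))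
        ≈⟨ *-congʳ (^-homo-* a k (n ∸ k)) ⟩
      a ^ k * a ^ (n ∸ k) * (f k * g (n ∸ k))
        ≈⟨ solve 4 (λ a b c d → a :* b :* (c :* d) := a :* c :* (b :* d)) refl _ _ _ _ ⟩
      a ^ k * f k * (a ^ (n ∸ k) * g (n ∸ k)) ∎)

  scale-+1ˢ : ∀ a f → scale a (f +ˢ 1ˢ) ≈ˢ scale a f +ˢ 1ˢ
  scale-+1ˢ a f zero    = trans (distribˡ _ _ _) (+-congˡ (*-identityˡ _))
  scale-+1ˢ a f (suc n) = trans (distribˡ _ _ _) (+-congˡ (zeroʳ _))

module EulerProperties (F : HeytingField c ℓ₁ ℓ₂) (char0 : CharacteristicZero F) where
  open GeneralizedEuler F char0
  open DirichletCharacter using (χ; periodic)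

  private
    R : CommutativeRing _ _
    R = fieldCommutativeRing F
    module R = CommutativeRing R

  open RingProperties R
  open PowerSeriesProperties R
  open Algebra.Properties.Semiring.Exp R.semiring using (^-homo-*; ^-congˡ)
  open Algebra.Properties.CommutativeSemiring.Exp R.commutativeSemiring using (^-distrib-*)
  open Algebra.Properties.Monoid.Mult R.+-monoid using (×-homo-+; ×-congʳ)
  open Algebra.Properties.Monoid.Mult R.*-monoid using () renaming (×-idem to ^-idem)
  open Algebra.Properties.Semiring.Mult R.semiring using (×-comm-*; ×-assoc-*; ×1-homo-*)
  open MultiSetoidReasoning
  open Solver R.commutativeSemiring using (solve; _:=_; _:+_; _:*_; con)
  open PowerSeries (fieldRawRing F) using (Series) renaming (rawRing to F[[t]]; _•_ to _•ˢ_)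
  private
    module S = CommutativeRing seriesCommutativeRing
    module RS = RingProperties seriesCommutativeRing
  open RawRing F[[t]] using ()
    renaming (_≈_ to _≈ˢ_; _+_ to _+ˢ_; _*_ to _*ˢ_; -_ to -ˢ_; 0# to 0ˢ; 1# to 1ˢ)
  open RingNotation F[[t]] using () renaming (∑ to ∑ˢ; _×_ to _×ˢ_; _^_ to _^ˢ_)
  open Solver S.commutativeSemiring using ()
    renaming (solve to solveˢ; _:=_ to _:=ˢ_; _:+_ to _:+ˢ_; _:*_ to _:*ˢ_; con to conˢ)

  -- Inverse factorials and exponential series.

  -1^odd : ∀ {n} → Odd n → (- 1#) ^ n ≈ - 1#
  -1^odd {n} odd = trans ([-x]^odd 1# {n} odd)
    (-‿cong (^-idem (*-identityˡ 1#) n {{odd⇒nonZero odd}}))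

  1/n!*n!≈1 : ∀ n → 1/ n ! * ι (n !) ≈ 1#
  1/n!*n!≈1 n = inv-inverseˡ (char0 (n !) {{n !≢0}})

  ι-n! : ∀ {n k} → k ≤ n → ι (n C k) * (ι (k !) * ι ((n ∸ k) !)) ≈ ι (n !)
  ι-n! {n} {k} k≤n = begin⟨ R.setoid ⟩
    ι (n C k) * (ι (k !) * ι ((n ∸ k) !))     ≈⟨ *-congˡ (×1-homo-* (k !) ((n ∸ k) !)) ⟨
    ι (n C k) * ι (k ! ℕ.* (n ∸ k) !)         ≈⟨ ×1-homo-* (n C k) (k ! ℕ.* (n ∸ k) !) ⟨
    ι ((n C k) ℕ.* (k ! ℕ.* (n ∸ k) !))       ≈⟨ reflexive (≡.cong ι (nCk*k!*[n∸k]!≡n! k≤n)) ⟩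
    ι (n !)                                   ∎

  -- Multiplying by (1/k! · k!)(1/(n-k)! · (n-k)!) = 1 lets the binomial coefficient absorb k! and
  -- (n-k)! into n!, which then cancels against 1/n!.
  1/n!*nCk : ∀ {n k} → k ≤ n → 1/ n ! * ι (n C k) ≈ 1/ k ! * 1/ (n ∸ k) !
  1/n!*nCk {n} {k} k≤n = begin⟨ R.setoid ⟩
    a * b
      ≈⟨ solve 2 (λ a b → a :* b := a :* b :* (con 1 :* con 1)) refl a b ⟩
    a * b * (1# * 1#)
      ≈⟨ *-congˡ (*-cong (1/n!*n!≈1 k) (1/n!*n!≈1 (n ∸ k))) ⟨
    a * b * (p * x * (q * y))
      ≈⟨ solve 6 (λ a b p q x y → a :* b :* (p :* x :* (q :* y))
                             := p :* q :* (a :* (b :* (x :* y)))) refl a b p q x y ⟩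
    p * q * (a * (b * (x * y)))
      ≈⟨ *-congˡ (*-congˡ (ι-n! k≤n)) ⟩
    p * q * (a * ι (n !))
      ≈⟨ *-congˡ (1/n!*n!≈1 n) ⟩
    p * q * 1#
      ≈⟨ *-identityʳ _ ⟩
    p * q ∎
    where
    a = 1/ n !
    b = ι (n C k)
    p = 1/ k !
    q = 1/ (n ∸ k) !
    x = ι (k !)
    y = ι ((n ∸ k) !)

  exp-cong : ∀ {a b} → a ≈ b → exp a ≈ˢ exp b
  exp-cong a≈b n = *-congˡ (^-congˡ n a≈b)

  exp-0 : exp 0# ≈ˢ 1ˢ
  -- `ι (0 !)` unfolds to `1# + 0#`, so 1# is first brought into that form.
  exp-0 zero    = trans (*-congˡ (sym (+-identityʳ 1#))) (1/n!*n!≈1 0)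
  exp-0 (suc n) = trans (*-congˡ (zeroˡ _)) (zeroʳ _)

  -- The binomial theorem divided by n! is, term by term, the convolution of the two exponentials.
  exp-+ : ∀ a b → exp (a + b) ≈ˢ exp a *ˢ exp b
  exp-+ a b n = begin⟨ R.setoid ⟩
    1/ n ! * (a + b) ^ n
      ≈⟨ *-congˡ (binomialTheorem n a b) ⟩
    1/ n ! * ∑ (suc n) (λ k → (n C k) × (a ^ k * b ^ (n ∸ k)))
      ≈⟨ *-distribˡ-∑ (suc n) (1/ n !) (λ k → (n C k) × (a ^ k * b ^ (n ∸ k))) ⟩
    ∑ (suc n) (λ k → 1/ n ! * ((n C k) × (a ^ k * b ^ (n ∸ k))))
      ≈⟨ ∑-cong (suc n) (λ k k<1+n → term k (s≤s⁻¹ k<1+n)) ⟩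
    (exp a *ˢ exp b) n ∎
    where
    open Algebra.Properties.CommutativeSemiring.Binomial R.commutativeSemiring
      using () renaming (theorem to binomialTheorem)
    term : ∀ k → k ≤ n →
      1/ n ! * ((n C k) × (a ^ k * b ^ (n ∸ k))) ≈ exp a k * exp b (n ∸ k)
    term k k≤n = begin⟨ R.setoid ⟩
      1/ n ! * ((n C k) × (u * v))
        ≈⟨ *-congˡ (×-congʳ (n C k) (*-identityˡ (u * v))) ⟨
      1/ n ! * ((n C k) × (1# * (u * v)))
        ≈⟨ *-congˡ (×-assoc-* (n C k) 1# (u * v)) ⟨
      1/ n ! * (ι (n C k) * (u * v))
        ≈⟨ *-assoc _ _ _ ⟨
      1/ n ! * ι (n C k) * (u * v)
        ≈⟨ *-congʳ (1/n!*nCk k≤n) ⟩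
      1/ k ! * 1/ (n ∸ k) ! * (u * v)
        ≈⟨ solve 4 (λ p q u v → p :* q :* (u :* v) := p :* u :* (q :* v)) refl _ _ u v ⟩
      exp a k * exp b (n ∸ k) ∎
      where
      u = a ^ k
      v = b ^ (n ∸ k)

  exp-ι-+ : ∀ m n → exp (ι (m ℕ.+ n)) ≈ˢ exp (ι m) *ˢ exp (ι n)
  exp-ι-+ m n = S.trans (exp-cong (×-homo-+ 1# m n)) (exp-+ (ι m) (ι n))

  exp-ι-* : ∀ m n → exp (ι (m ℕ.* n)) ≈ˢ exp (ι n) ^ˢ m
  exp-ι-* zero    n = exp-0
  exp-ι-* (suc m) n = S.trans (exp-ι-+ n (m ℕ.* n)) (S.*-congˡ {exp (ι n)} (exp-ι-* m n))

  scale-exp : ∀ a b → scale a (exp b) ≈ˢ exp (a * b)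
  scale-exp a b n = begin⟨ R.setoid ⟩
    a ^ n * (1/ n ! * b ^ n)  ≈⟨ solve 3 (λ x y z → x :* (y :* z) := y :* (x :* z)) refl _ _ _ ⟩
    1/ n ! * (a ^ n * b ^ n)  ≈⟨ *-congˡ (^-distrib-* a b n) ⟨
    1/ n ! * (a * b) ^ n      ∎

  scale-denominator : ∀ m n → scale (ι m) (denominator n) ≈ˢ denominator (m ℕ.* n)
  scale-denominator m n = S.trans
    (scale-+1ˢ (ι m) (exp (ι n)))
    (S.+-congʳ (S.trans (scale-exp (ι m) (ι n)) (exp-cong (sym (×1-homo-* m n)))))

  -- Alternating character sums as multiples of the quotient series.

  module _ {d : ℕ} (ψ : DirichletCharacter d) where

    summand : ℕ → Series
    summand l = ((- 1#) ^ l * χ ψ (+ l)) •ˢ exp (ι l)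

    Q : Series
    Q = quotient (numerator ψ) (denominator d) (denominator₀#0 d)

    -- `T` includes its upper limit, so n terms end at n - 1. Truncated subtraction leaves one term
    -- when n = 0, hence the `NonZero` hypothesis in `powerSumSeries-∑`.
    powerSumSeries : ℕ → Series
    powerSumSeries n k = 1/ k ! * T ψ k (n ∸ 1)

    -- Under a shift by d the character is unchanged, the sign flips because d is odd, and the
    -- exponential gains a factor e^{dt}.
    summand-+d : Odd d → ∀ l → summand (d ℕ.+ l) ≈ˢ -ˢ exp (ι d) *ˢ summand l
    summand-+d odd l n = begin⟨ R.setoid ⟩
      (- 1#) ^ (d ℕ.+ l) * χ ψ (+ (d ℕ.+ l)) * exp (ι (d ℕ.+ l)) n
        ≈⟨ *-cong (*-cong sign periodicity) (exp-ι-+ d l n) ⟩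
      - 1# * (- 1#) ^ l * χ ψ (+ l) * (exp (ι d) *ˢ exp (ι l)) n
        ≈⟨ solve 4 (λ m s x y → m :* s :* x :* y := m :* (s :* x :* y)) refl (- 1#) _ _ _ ⟩
      - 1# * (a * (exp (ι d) *ˢ exp (ι l)) n)
        ≈⟨ -1*x≈-x _ ⟩
      - (a * (exp (ι d) *ˢ exp (ι l)) n)
        ≈⟨ -‿cong (*-congˡ (*ˢ-comm (exp (ι d)) (exp (ι l)) n)) ⟩
      - (a * (exp (ι l) *ˢ exp (ι d)) n)
        ≈⟨ -‿cong (•-*ˢ-assoc a (exp (ι l)) (exp (ι d)) n) ⟨
      - (summand l *ˢ exp (ι d)) n
        ≈⟨ -‿cong (*ˢ-comm (summand l) (exp (ι d)) n) ⟩
      - (exp (ι d) *ˢ summand l) n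
        ≈⟨ -ˢ‿distribˡ-*ˢ (exp (ι d)) (summand l) n ⟩
      (-ˢ exp (ι d) *ˢ summand l) n ∎
      where
      open Algebra.Properties.Ring R.ring using (-1*x≈-x)
      open Algebra.Properties.Ring S.ring using () renaming (-‿distribˡ-* to -ˢ‿distribˡ-*ˢ)
      a : Carrier
      a = (- 1#) ^ l * χ ψ (+ l)
      sign : (- 1#) ^ (d ℕ.+ l) ≈ - 1# * (- 1#) ^ l
      sign = trans (^-homo-* (- 1#) d l) (*-congʳ (-1^odd {d} odd))
      periodicity : χ ψ (+ (d ℕ.+ l)) ≈ χ ψ (+ l)
      periodicity = begin⟨ R.setoid ⟩
        χ ψ (+ (d ℕ.+ l))  ≈⟨ reflexive (≡.cong (λ m → χ ψ (+ m)) (ℕ.+-comm d l)) ⟩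
        χ ψ (+ (l ℕ.+ d))  ≈⟨ periodic ψ (+ l) ⟩
        χ ψ (+ l)          ∎

    -- Put u = -e^{dt}. Each block of d summands is u times the preceding one, and twice the first
    -- block is Q(1 - u), so w blocks form a geometric sum with value Q(1 - u^w). Keeping Q u^w on
    -- the left avoids subtraction and makes the induction independent of the parity of w.
    ∑-summand : Odd d → ∀ w →
      2 ×ˢ ∑ˢ (w ℕ.* d) summand +ˢ Q *ˢ (-ˢ exp (ι d)) ^ˢ w ≈ˢ Q
    ∑-summand odd zero    =
      solveˢ 1 (λ q → (conˢ 0 :+ˢ (conˢ 0 :+ˢ conˢ 0)) :+ˢ q :*ˢ conˢ 1 :=ˢ q) S.refl Q
    ∑-summand odd (suc w) = begin⟨ S.setoid ⟩
      2 ×ˢ ∑ˢ (d ℕ.+ w ℕ.* d) summand +ˢ Q *ˢ (u *ˢ v)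
        ≈⟨ S.+-congʳ (×ˢ-congʳ 2 blocks) ⟩
      2 ×ˢ (A +ˢ u *ˢ B) +ˢ Q *ˢ (u *ˢ v)
        -- `2 ×ˢ` is unfolded to x + (x + 0) for the solver; afterwards `2 ×ˢ A` is `numerator ψ` by
        -- definition.
        ≈⟨ solveˢ 5 (λ A B Q u v →
             (A :+ˢ u :*ˢ B) :+ˢ ((A :+ˢ u :*ˢ B) :+ˢ conˢ 0) :+ˢ Q :*ˢ (u :*ˢ v) :=ˢ
             (A :+ˢ (A :+ˢ conˢ 0)) :+ˢ u :*ˢ (B :+ˢ (B :+ˢ conˢ 0) :+ˢ Q :*ˢ v))
             S.refl A B Q u v ⟩
      numerator ψ +ˢ u *ˢ (2 ×ˢ B +ˢ Q *ˢ v)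
        ≈⟨ S.+-cong (S.sym (quotient-correct (numerator ψ) (denominator d) (denominator₀#0 d)))
                    (S.*-congˡ {u} (∑-summand odd w)) ⟩
      Q *ˢ (e +ˢ 1ˢ) +ˢ u *ˢ Q
        -- The solver treats u and e as independent, so e + u is isolated here and cancelled in the
        -- next step.
        ≈⟨ solveˢ 3 (λ Q u e → Q :*ˢ (e :+ˢ conˢ 1) :+ˢ u :*ˢ Q
                            :=ˢ Q :*ˢ (e :+ˢ u) :+ˢ Q) S.refl Q u e ⟩
      Q *ˢ (e +ˢ u) +ˢ Q
        ≈⟨ S.+-congʳ (S.trans (S.*-congˡ {Q} (S.-‿inverseʳ e)) (S.zeroʳ Q)) ⟩
      0ˢ +ˢ Q
        ≈⟨ S.+-identityˡ Q ⟩
      Q ∎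
      where
      open Algebra.Properties.Monoid.Mult S.+-monoid using () renaming (×-congʳ to ×ˢ-congʳ)
      e u v A B : Series
      e = exp (ι d)
      u = -ˢ e
      v = u ^ˢ w
      A = ∑ˢ d summand
      B = ∑ˢ (w ℕ.* d) summand
      blocks : ∑ˢ (d ℕ.+ w ℕ.* d) summand ≈ˢ A +ˢ u *ˢ B
      blocks = S.trans (RS.∑-split d (w ℕ.* d) summand)
        (S.+-congˡ {A} (S.trans (RS.∑-cong (w ℕ.* d) (λ l _ → summand-+d odd l))
                                (S.sym (RS.*-distribˡ-∑ (w ℕ.* d) u summand))))

    -- The coefficient of t^k in e^{lt} is l^k / k!, so the sum over l may be taken before or after
    -- extracting coefficients.
    powerSumSeries-∑ : ∀ n → .{{NonZero n}} → powerSumSeries n ≈ˢ 2 ×ˢ ∑ˢ n summand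
    -- Matching on a successor makes `suc (n ∸ 1)`, the number of terms in `T`, compute to n.
    powerSumSeries-∑ n@(suc _) k = begin⟨ R.setoid ⟩
      1/ k ! * (2 × ∑ n (λ l → a l * ι l ^ k))
        ≈⟨ ×-comm-* 2 _ _ ⟩
      2 × (1/ k ! * ∑ n (λ l → a l * ι l ^ k))
        ≈⟨ ×-congʳ 2 (*-distribˡ-∑ n (1/ k !) (λ l → a l * ι l ^ k)) ⟩
      2 × ∑ n (λ l → 1/ k ! * (a l * ι l ^ k))
        ≈⟨ ×-congʳ 2 (∑-cong n (λ l _ →
             solve 3 (λ x y z → x :* (y :* z) := y :* (x :* z)) refl (1/ k !) (a l) (ι l ^ k))) ⟩
      2 × ∑ n (λ l → summand l k)
        ≈⟨ ×-congʳ 2 (∑ˢ-lookup n summand k) ⟨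
      2 × ∑ˢ n summand k ∎
      where
      a : ℕ → Carrier
      a l = (- 1#) ^ l * χ ψ (+ l)

    -- For odd w the power (-e^{dt})^w is -e^{dwt}, so the geometric sum Q(1 - u^w) of `∑-summand`
    -- becomes Q(1 + e^{dwt}).
    powerSumSeries≈Q*denominator : Odd d → ∀ w → Odd w →
      powerSumSeries (w ℕ.* d) ≈ˢ Q *ˢ denominator (w ℕ.* d)
    powerSumSeries≈Q*denominator odd w odd-w = begin⟨ S.setoid ⟩
      powerSumSeries (w ℕ.* d)
        ≈⟨ powerSumSeries-∑ (w ℕ.* d)
             {{ℕ.m*n≢0 w d {{odd⇒nonZero odd-w}} {{odd⇒nonZero odd}}}} ⟩
      B
        ≈⟨ S.trans (S.+-congˡ {B} (S.trans (S.*-congˡ {Q} v+D≈0) (S.zeroʳ Q)))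
                   (S.+-identityʳ B) ⟨
      -- The vanishing term Q(v + D) is added to produce the left-hand side of `∑-summand`.
      B +ˢ Q *ˢ (v +ˢ D)
        ≈⟨ solveˢ 4 (λ B Q v D → B :+ˢ Q :*ˢ (v :+ˢ D) :=ˢ (B :+ˢ Q :*ˢ v) :+ˢ Q :*ˢ D)
             S.refl B Q v D ⟩
      (B +ˢ Q *ˢ v) +ˢ Q *ˢ D
        ≈⟨ S.+-congʳ (∑-summand odd w) ⟩
      Q +ˢ Q *ˢ D
        ≈⟨ solveˢ 2 (λ Q D → Q :+ˢ Q :*ˢ D :=ˢ Q :*ˢ (D :+ˢ conˢ 1)) S.refl Q D ⟩
      Q *ˢ denominator (w ℕ.* d) ∎
      where
      B v D : Series
      B = 2 ×ˢ ∑ˢ (w ℕ.* d) summand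
      v = (-ˢ exp (ι d)) ^ˢ w
      D = exp (ι (w ℕ.* d))
      v+D≈0 : v +ˢ D ≈ˢ 0ˢ
      v+D≈0 = S.trans
        (S.+-cong (RS.[-x]^odd (exp (ι d)) {w} odd-w) (exp-ι-* w d))
        (S.-‿inverseˡ (exp (ι d) ^ˢ w))

  -- Coefficients of polynomials.

  coeff-+ₚ : ∀ p q n → coeff (p +ₚ q) n ≈ coeff p n + coeff q n
  coeff-+ₚ []      q       n       = sym (+-identityˡ _)
  coeff-+ₚ (a ∷ p) []      n       = sym (+-identityʳ _)
  coeff-+ₚ (a ∷ p) (b ∷ q) zero    = refl
  coeff-+ₚ (a ∷ p) (b ∷ q) (suc n) = coeff-+ₚ p q n

  coeff-• : ∀ a p n → coeff (a • p) n ≈ a * coeff p n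
  coeff-• a []      n       = sym (zeroʳ a)
  coeff-• a (b ∷ p) zero    = refl
  coeff-• a (b ∷ p) (suc n) = coeff-• a p n

  coeff-∑ₚ : ∀ n p m → coeff (∑ₚ n p) m ≈ ∑ n (λ i → coeff (p i) m)
  coeff-∑ₚ zero    p m = refl
  coeff-∑ₚ (suc n) p m =
    trans (coeff-+ₚ (p 0) _ m) (+-congˡ (coeff-∑ₚ n (λ i → p (suc i)) m))

  -- Multiplication by a constant leaves the summand `0# ∷ []` rather than the empty list.
  coeff-0∷[] : ∀ n → coeff (0# ∷ []) n ≈ 0#
  coeff-0∷[] zero    = refl
  coeff-0∷[] (suc n) = refl

  coeff-const-*ₚ : ∀ a p n → coeff (const a *ₚ p) n ≈ a * coeff p n
  coeff-const-*ₚ a p n = begin⟨ R.setoid ⟩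
    coeff (a • p +ₚ (0# ∷ [])) n           ≈⟨ coeff-+ₚ (a • p) (0# ∷ []) n ⟩
    coeff (a • p) n + coeff (0# ∷ []) n    ≈⟨ +-cong (coeff-• a p n) (coeff-0∷[] n) ⟩
    a * coeff p n + 0#                     ≈⟨ +-identityʳ _ ⟩
    a * coeff p n                          ∎

  -- Multiplication by bX shifts coefficients. The constant term is only assumed equal to zero, so
  -- that both `X` and `w • X`, whose constant term is `w * 0#`, are covered.
  module _ {a : Carrier} (a≈0 : a ≈ 0#) (b : Carrier) where

    coeff-linear-*ₚ-zero : ∀ p → coeff ((a ∷ b ∷ []) *ₚ p) 0 ≈ 0#
    coeff-linear-*ₚ-zero p = begin⟨ R.setoid ⟩
      coeff (a • p +ₚ (0# ∷ const b *ₚ p)) 0  ≈⟨ coeff-+ₚ (a • p) (0# ∷ const b *ₚ p) 0 ⟩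
      coeff (a • p) 0 + 0#                    ≈⟨ +-identityʳ _ ⟩
      coeff (a • p) 0                         ≈⟨ coeff-• a p 0 ⟩
      a * coeff p 0                           ≈⟨ *-congʳ a≈0 ⟩
      0# * coeff p 0                          ≈⟨ zeroˡ _ ⟩
      0#                                      ∎

    coeff-linear-*ₚ-suc : ∀ p n → coeff ((a ∷ b ∷ []) *ₚ p) (suc n) ≈ b * coeff p n
    coeff-linear-*ₚ-suc p n = begin⟨ R.setoid ⟩
      coeff (a • p +ₚ (0# ∷ const b *ₚ p)) (suc n)
        ≈⟨ coeff-+ₚ (a • p) (0# ∷ const b *ₚ p) (suc n) ⟩
      coeff (a • p) (suc n) + coeff (const b *ₚ p) n
        ≈⟨ +-cong (coeff-• a p (suc n)) (coeff-const-*ₚ b p n) ⟩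
      a * coeff p (suc n) + b * coeff p n
        ≈⟨ +-congʳ (trans (*-congʳ a≈0) (zeroˡ _)) ⟩
      0# + b * coeff p n
        ≈⟨ +-identityˡ _ ⟩
      b * coeff p n ∎

  -- Composition follows Horner's scheme: each multiplication by wX shifts the coefficients by one
  -- and contributes a factor w.
  coeff-⟨wX⟩ : ∀ w p n → coeff (p ⟨ w • X ⟩) n ≈ w ^ n * coeff p n
  coeff-⟨wX⟩ w []      n       = sym (zeroʳ _)
  coeff-⟨wX⟩ w (a ∷ p) zero    = begin⟨ R.setoid ⟩
    coeff (const a +ₚ (w • X) *ₚ (p ⟨ w • X ⟩)) 0
      ≈⟨ coeff-+ₚ (const a) ((w • X) *ₚ (p ⟨ w • X ⟩)) 0 ⟩
    a + coeff ((w • X) *ₚ (p ⟨ w • X ⟩)) 0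
      ≈⟨ +-congˡ (coeff-linear-*ₚ-zero (zeroʳ w) (w * 1#) (p ⟨ w • X ⟩)) ⟩
    a + 0#
      ≈⟨ solve 1 (λ a → a :+ con 0 := con 1 :* a) refl a ⟩
    1# * a ∎
  coeff-⟨wX⟩ w (a ∷ p) (suc n) = begin⟨ R.setoid ⟩
    coeff (const a +ₚ (w • X) *ₚ (p ⟨ w • X ⟩)) (suc n)
      ≈⟨ coeff-+ₚ (const a) ((w • X) *ₚ (p ⟨ w • X ⟩)) (suc n) ⟩
    0# + coeff ((w • X) *ₚ (p ⟨ w • X ⟩)) (suc n)
      ≈⟨ +-congˡ (coeff-linear-*ₚ-suc (zeroʳ w) (w * 1#) (p ⟨ w • X ⟩) n) ⟩
    0# + w * 1# * coeff (p ⟨ w • X ⟩) n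
      ≈⟨ +-congˡ (*-congˡ (coeff-⟨wX⟩ w p n)) ⟩
    0# + w * 1# * (w ^ n * coeff p n)
      ≈⟨ solve 3 (λ w x y → con 0 :+ w :* con 1 :* (x :* y) := w :* x :* y) refl w _ _ ⟩
    w ^ suc n * coeff p n ∎

  -- Homogeneity of e^{xt} in x and t.

  -- coeff (X ^ₚ n) m vanishes unless m = n.
  coeff-X^-homogeneous : ∀ w n m → w ^ n * coeff (X ^ₚ n) m ≈ w ^ m * coeff (X ^ₚ n) m
  coeff-X^-homogeneous w zero    zero    = refl
  coeff-X^-homogeneous w zero    (suc m) = trans (zeroʳ _) (sym (zeroʳ _))
  coeff-X^-homogeneous w (suc n) zero    = trans (vanish _) (sym (vanish _))
    where
    vanish : ∀ x → x * coeff (X ^ₚ suc n) 0 ≈ 0#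
    vanish x = trans (*-congˡ (coeff-linear-*ₚ-zero refl 1# (X ^ₚ n))) (zeroʳ x)
  coeff-X^-homogeneous w (suc n) (suc m) = begin⟨ R.setoid ⟩
    w * w ^ n * coeff (X ^ₚ suc n) (suc m)
      ≈⟨ *-congˡ (coeff-linear-*ₚ-suc refl 1# (X ^ₚ n) m) ⟩
    w * w ^ n * (1# * coeff (X ^ₚ n) m)
      ≈⟨ solve 3 (λ w x y → w :* x :* (con 1 :* y) := w :* (x :* y)) refl w _ _ ⟩
    w * (w ^ n * coeff (X ^ₚ n) m)
      ≈⟨ *-congˡ (coeff-X^-homogeneous w n m) ⟩
    w * (w ^ m * coeff (X ^ₚ n) m)
      ≈⟨ solve 3 (λ w x y → w :* (x :* y) := w :* x :* (con 1 :* y)) refl w _ _ ⟩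
    w * w ^ m * (1# * coeff (X ^ₚ n) m)
      ≈⟨ *-congˡ (coeff-linear-*ₚ-suc refl 1# (X ^ₚ n) m) ⟨
    w * w ^ m * coeff (X ^ₚ suc n) (suc m) ∎

  -- The series of coefficients of xᵐ in e^{xt}.
  expXCoeff : ℕ → Series
  expXCoeff m n = coeff (expX n) m

  -- Both sides are the coefficient of x^m in e^{abxt}: only the degree n = m contributes, and there
  -- either side carries (ab)^m.
  scale-expXCoeff : ∀ a b m → a ^ m •ˢ scale b (expXCoeff m) ≈ˢ b ^ m •ˢ scale a (expXCoeff m)
  scale-expXCoeff a b m n = begin⟨ R.setoid ⟩
    a ^ m * (b ^ n * coeff (1/ n ! • X ^ₚ n) m)
      ≈⟨ *-congˡ (homogeneous b) ⟩
    a ^ m * (b ^ m * coeff (1/ n ! • X ^ₚ n) m)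
      ≈⟨ solve 3 (λ x y z → x :* (y :* z) := y :* (x :* z)) refl _ _ _ ⟩
    b ^ m * (a ^ m * coeff (1/ n ! • X ^ₚ n) m)
      ≈⟨ *-congˡ (homogeneous a) ⟨
    b ^ m * (a ^ n * coeff (1/ n ! • X ^ₚ n) m) ∎
    where
    homogeneous : ∀ w → w ^ n * coeff (1/ n ! • X ^ₚ n) m ≈ w ^ m * coeff (1/ n ! • X ^ₚ n) m
    homogeneous w = begin⟨ R.setoid ⟩
      w ^ n * coeff (1/ n ! • X ^ₚ n) m
        ≈⟨ *-congˡ (coeff-• (1/ n !) (X ^ₚ n) m) ⟩
      w ^ n * (1/ n ! * coeff (X ^ₚ n) m)
        ≈⟨ solve 3 (λ x y z → x :* (y :* z) := y :* (x :* z)) refl _ _ _ ⟩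
      1/ n ! * (w ^ n * coeff (X ^ₚ n) m)
        ≈⟨ *-congˡ (coeff-X^-homogeneous w n m) ⟩
      1/ n ! * (w ^ m * coeff (X ^ₚ n) m)
        ≈⟨ solve 3 (λ x y z → x :* (y :* z) := y :* (x :* z)) refl _ _ _ ⟩
      w ^ m * (1/ n ! * coeff (X ^ₚ n) m)
        ≈⟨ *-congˡ (coeff-• (1/ n !) (X ^ₚ n) m) ⟨
      w ^ m * coeff (1/ n ! • X ^ₚ n) m ∎

  -- The two sides of the theorem, compared coefficient by coefficient.

  module _ {d : ℕ} (ψ : DirichletCharacter d) where

    -- The factor of e^{xt} in the generating series has constant coefficients, so extracting the
    -- coefficient of x^m commutes with the product. For each m, the problem moves from F[x][[t]] to
    -- F[[t]].
    coeff-E : ∀ n m → coeff (E ψ n) m ≈ ι (n !) * (Q ψ *ˢ expXCoeff m) n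
    coeff-E n m = begin⟨ R.setoid ⟩
      coeff (ι (n !) • generatingSeries ψ n) m
        ≈⟨ coeff-• (ι (n !)) (generatingSeries ψ n) m ⟩
      ι (n !) * coeff (generatingSeries ψ n) m
        ≈⟨ *-congˡ (coeff-∑ₚ (suc n) (λ k → const (Q ψ k) *ₚ expX (n ∸ k)) m) ⟩
      ι (n !) * ∑ (suc n) (λ k → coeff (const (Q ψ k) *ₚ expX (n ∸ k)) m)
        ≈⟨ *-congˡ (∑-cong (suc n) (λ k _ → coeff-const-*ₚ (Q ψ k) (expX (n ∸ k)) m)) ⟩
      ι (n !) * (Q ψ *ˢ expXCoeff m) n ∎

    module _ (w₁ w₂ l : ℕ) where

      -- Exchanging w₁ and w₂ turns one side of the theorem into the other, so only a symmetry
      -- remains to be shown.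
      side : Poly
      side = ∑ₚ (suc l) (λ i →
        (ι (l C i) * T ψ (l ∸ i) (d ℕ.* w₁ ∸ 1) * ι w₁ ^ i * ι w₂ ^ (l ∸ i)) • E ψ i ⟨ ι w₂ • X ⟩)

      -- A binomial sum is l! times a coefficient of a product of exponential generating series; the
      -- factor w₂^m comes from evaluating the Euler polynomials at w₂x.
      coeff-side : ∀ m → coeff side m ≈
        ι (l !) * (ι w₂ ^ m *
          (scale (ι w₁) (Q ψ *ˢ expXCoeff m) *ˢ scale (ι w₂) (powerSumSeries ψ (d ℕ.* w₁))) l)
      coeff-side m = begin⟨ R.setoid ⟩
        coeff side m
          ≈⟨ coeff-∑ₚ (suc l) (λ i → a i • E ψ i ⟨ ι w₂ • X ⟩) m ⟩
        ∑ (suc l) (λ i → coeff (a i • E ψ i ⟨ ι w₂ • X ⟩) m)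
          ≈⟨ ∑-cong (suc l) (λ i i<1+l → term i (s≤s⁻¹ i<1+l)) ⟩
        ∑ (suc l) (λ i → ι (l !) * ι w₂ ^ m * (g i * h (l ∸ i)))
          ≈⟨ *-distribˡ-∑ (suc l) (ι (l !) * ι w₂ ^ m) (λ i → g i * h (l ∸ i)) ⟨
        ι (l !) * ι w₂ ^ m * (g *ˢ h) l
          ≈⟨ *-assoc _ _ _ ⟩
        ι (l !) * (ι w₂ ^ m * (g *ˢ h) l) ∎
        where
        a : ℕ → Carrier
        a i = ι (l C i) * T ψ (l ∸ i) (d ℕ.* w₁ ∸ 1) * ι w₁ ^ i * ι w₂ ^ (l ∸ i)
        g h : Series
        g = scale (ι w₁) (Q ψ *ˢ expXCoeff m)
        h = scale (ι w₂) (powerSumSeries ψ (d ℕ.* w₁))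
        term : ∀ i → i ≤ l → coeff (a i • E ψ i ⟨ ι w₂ • X ⟩) m ≈
          ι (l !) * ι w₂ ^ m * (g i * h (l ∸ i))
        term i i≤l = begin⟨ R.setoid ⟩
          coeff (a i • E ψ i ⟨ ι w₂ • X ⟩) m
            ≈⟨ coeff-• (a i) (E ψ i ⟨ ι w₂ • X ⟩) m ⟩
          a i * coeff (E ψ i ⟨ ι w₂ • X ⟩) m
            ≈⟨ *-congˡ (coeff-⟨wX⟩ (ι w₂) (E ψ i) m) ⟩
          a i * (ι w₂ ^ m * coeff (E ψ i) m)
            ≈⟨ *-congˡ (*-congˡ (coeff-E i m)) ⟩
          b * t * x * y * (z * (p * q))
            ≈⟨ solve 7 (λ b t x y z p q → b :* t :* x :* y :* (z :* (p :* q)) :=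
                 con 1 :* (b :* t :* x :* y :* (z :* (p :* q)))) refl b t x y z p q ⟩
          -- The inserted 1 becomes (1/(l-i)!) · (l-i)!: the inverse normalises `T` into the power
          -- sum series, and (l-i)! joins i! and the binomial coefficient to give l!.
          1# * (b * t * x * y * (z * (p * q)))
            ≈⟨ *-congʳ (1/n!*n!≈1 (l ∸ i)) ⟨
          s * r * (b * t * x * y * (z * (p * q)))
            ≈⟨ solve 9 (λ b t x y z p q r s → s :* r :* (b :* t :* x :* y :* (z :* (p :* q))) :=
                 b :* (p :* r) :* z :* (x :* q :* (y :* (s :* t)))) refl b t x y z p q r s ⟩
          b * (p * r) * z * (g i * h (l ∸ i))
            ≈⟨ *-congʳ (*-congʳ (ι-n! i≤l)) ⟩
          ι (l !) * z * (g i * h (l ∸ i)) ∎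
          where
          b t x y z p q r s : Carrier
          b = ι (l C i)
          t = T ψ (l ∸ i) (d ℕ.* w₁ ∸ 1)
          x = ι w₁ ^ i
          y = ι w₂ ^ (l ∸ i)
          z = ι w₂ ^ m
          p = ι (i !)
          q = (Q ψ *ˢ expXCoeff m) i
          r = ι ((l ∸ i) !)
          s = 1/ (l ∸ i) !

    -- The result separates three factors, each symmetric in w₁ and w₂: the coefficient of x^m in
    -- e^{w₁w₂xt}, the product Q(w₁t) Q(w₂t), and e^{dw₁w₂t} + 1.
    scaled-product : Odd d → ∀ w₁ w₂ → Odd w₁ → ∀ m →
      ι w₂ ^ m •ˢ (scale (ι w₁) (Q ψ *ˢ expXCoeff m) *ˢ
                   scale (ι w₂) (powerSumSeries ψ (d ℕ.* w₁))) ≈ˢ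
      (ι w₂ ^ m •ˢ scale (ι w₁) (expXCoeff m)) *ˢ
        (scale (ι w₁) (Q ψ) *ˢ scale (ι w₂) (Q ψ) *ˢ denominator (w₂ ℕ.* (w₁ ℕ.* d)))
    scaled-product odd w₁ w₂ odd₁ m = begin⟨ S.setoid ⟩
      b •ˢ (scale a (Q ψ *ˢ M) *ˢ scale (ι w₂) (powerSumSeries ψ (d ℕ.* w₁)))
        ≈⟨ •ˢ-congˡ (S.*-cong (scale-*ˢ a (Q ψ) M) powerSum) ⟩
      b •ˢ ((q₁ *ˢ N) *ˢ (q₂ *ˢ D))
        ≈⟨ •ˢ-congˡ (solveˢ 4 (λ q₁ N q₂ D → (q₁ :*ˢ N) :*ˢ (q₂ :*ˢ D) :=ˢ
                                             N :*ˢ (q₁ :*ˢ q₂ :*ˢ D)) S.refl q₁ N q₂ D) ⟩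
      b •ˢ (N *ˢ (q₁ *ˢ q₂ *ˢ D))
        ≈⟨ •-*ˢ-assoc b N (q₁ *ˢ q₂ *ˢ D) ⟨
      (b •ˢ N) *ˢ (q₁ *ˢ q₂ *ˢ D) ∎
      where
      a b : Carrier
      a = ι w₁
      b = ι w₂ ^ m
      M N q₁ q₂ D : Series
      M = expXCoeff m
      N = scale a M
      q₁ = scale a (Q ψ)
      q₂ = scale (ι w₂) (Q ψ)
      D = denominator (w₂ ℕ.* (w₁ ℕ.* d))
      •ˢ-congˡ : ∀ {f g} → f ≈ˢ g → b •ˢ f ≈ˢ b •ˢ g
      •ˢ-congˡ f≈g n = *-congˡ (f≈g n)
      powerSum : scale (ι w₂) (powerSumSeries ψ (d ℕ.* w₁)) ≈ˢ q₂ *ˢ D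
      powerSum = begin⟨ S.setoid ⟩
        scale (ι w₂) (powerSumSeries ψ (d ℕ.* w₁))
          -- The block decomposition uses the order w₁ · d, since `suc w ℕ.* d` computes to
          -- `d ℕ.+ w ℕ.* d`.
          ≈⟨ S.reflexive (≡.cong (λ n → scale (ι w₂) (powerSumSeries ψ n)) (ℕ.*-comm d w₁)) ⟩
        scale (ι w₂) (powerSumSeries ψ (w₁ ℕ.* d))
          ≈⟨ scale-cong (ι w₂) (powerSumSeries≈Q*denominator ψ odd w₁ odd₁) ⟩
        scale (ι w₂) (Q ψ *ˢ denominator (w₁ ℕ.* d))
          ≈⟨ scale-*ˢ (ι w₂) (Q ψ) (denominator (w₁ ℕ.* d)) ⟩
        q₂ *ˢ scale (ι w₂) (denominator (w₁ ℕ.* d))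
          ≈⟨ S.*-congˡ {q₂} (scale-denominator w₂ (w₁ ℕ.* d)) ⟩
        q₂ *ˢ D ∎

    side-comm : Odd d → ∀ w₁ w₂ → Odd w₁ → Odd w₂ → ∀ l → side w₁ w₂ l ≈ₚ side w₂ w₁ l
    side-comm odd w₁ w₂ odd₁ odd₂ l m = begin⟨ R.setoid ⟩
      coeff (side w₁ w₂ l) m
        ≈⟨ coeff-side w₁ w₂ l m ⟩
      _
        ≈⟨ *-congˡ (scaled-product odd w₁ w₂ odd₁ m l) ⟩
      ι (l !) * ((ι w₂ ^ m •ˢ scale (ι w₁) (expXCoeff m)) *ˢ (q₁ *ˢ q₂ *ˢ D w₂ w₁)) l
        -- The three symmetric factors are exchanged independently.
        ≈⟨ *-congˡ (S.*-cong (scale-expXCoeff (ι w₂) (ι w₁) m)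
             (S.*-cong (S.*-comm q₁ q₂) (S.reflexive (≡.cong denominator swap))) l) ⟩
      ι (l !) * ((ι w₁ ^ m •ˢ scale (ι w₂) (expXCoeff m)) *ˢ (q₂ *ˢ q₁ *ˢ D w₁ w₂)) l
        ≈⟨ *-congˡ (scaled-product odd w₂ w₁ odd₂ m l) ⟨
      _
        ≈⟨ coeff-side w₂ w₁ l m ⟨
      coeff (side w₂ w₁ l) m ∎
      where
      open Algebra.Properties.CommutativeSemigroup ℕ.*-commutativeSemigroup using (x∙yz≈y∙xz)
      q₁ q₂ : Series
      q₁ = scale (ι w₁) (Q ψ)
      q₂ = scale (ι w₂) (Q ψ)
      D : ℕ → ℕ → Series
      D u v = denominator (u ℕ.* (v ℕ.* d))
      swap : w₂ ℕ.* (w₁ ℕ.* d) ≡ w₁ ℕ.* (w₂ ℕ.* d)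
      swap = x∙yz≈y∙xz w₂ w₁ d

theorem1 : ∀ {c ℓ₁ ℓ₂} (F : HeytingField c ℓ₁ ℓ₂) (char0 : CharacteristicZero F) →
    let open GeneralizedEuler F char0 in
    (d : ℕ) → Odd d →
    (ψ : DirichletCharacter d) → HasConductor ψ d →
    (w₁ w₂ : ℕ) → Odd w₁ → Odd w₂ →
    (l : ℕ) →
    ∑ₚ (suc l) (λ i →
      (ι (l C i) * T ψ (l ∸ i) (d ℕ.* w₁ ∸ 1) * ι w₁ ^ i * ι w₂ ^ (l ∸ i)) • E ψ i ⟨ ι w₂ • X ⟩)
    ≈ₚ
    ∑ₚ (suc l) (λ i →
      (ι (l C i) * T ψ (l ∸ i) (d ℕ.* w₂ ∸ 1) * ι w₂ ^ i * ι w₁ ^ (l ∸ i)) • E ψ i ⟨ ι w₁ • X ⟩)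
theorem1 F char0 d odd ψ _ w₁ w₂ odd₁ odd₂ l =
  EulerProperties.side-comm F char0 ψ odd w₁ w₂ odd₁ odd₂ l
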